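{- Let $G$ be a disconnected split graph (finite, simple, undirected). Case 1: If $G$ has no connected component with at least two vertices, so that $G$ consists of $n$ isolated vertices, then $b(G) = n$. Case 2: If $G$ consists of one connected component $G_c$ with at least two vertices together with a set of $n$ isolated vertices ($n \ge 1$), then $b(G) \leq 3$ if $n \leq 2$, and $b(G) = n+1$ otherwise.
   Context: A split graph is a graph whose vertex set can be partitioned into a clique (a set of mutually adjacent vertices) and an independent set (a set of mutually non-adjacent vertices). A disconnected split graph is either a set of isolated vertices, or one connected split component with at least two vertices together with a set of isolated vertices. Graph burning: initially all vertices of a finite simple undirected graph $G$ are unburned. The process runs in rounds $t = 1, 2, 3, \dots$. In round $t$, a vertex $x_t$ that is not burned at the end of round $t-1$ is chosen as a new source of fire and becomes burned; simultaneously, every vertex adjacent to a vertex that was burned at the end of round $t-1$ becomes burned. Burned vertices remain burned. The process ends at the first round after which all vertices of $G$ are burned. The burning number $b(G)$ is the minimum, over all choices of sources, of the number of rounds needed to burn all vertices of $G$. -}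

module Defs where

open import Data.Fin using (Fin; toℕ)
open import Data.Fin.Properties using (_≟_; all?; any?; toℕ-injective; toℕ<n)
open import Data.Fin.Subset using (Subset; _∈_; _∉_; ∁; ∣_∣)
open import Data.Nat as ℕ using (ℕ; zero; suc; _≤_; _<_; _≥_; s≤s⁻¹)
import Data.Nat.Properties as ℕ
open import Data.Product using (∃; ∃-syntax; _×_; _,_; proj₁)
open import Data.Sum using (_⊎_; inj₁; inj₂)
open import Function using (_⇔_)
open import Relation.Binary using (Rel; Symmetric)
import Relation.Binary as Binary
open import Relation.Binary.Construct.Closure.ReflexiveTransitive using (Star)
open import Relation.Binary.PropositionalEquality using (_≡_; _≢_; trans; sym)
open import Relation.Nullary using (¬_; yes; no; ¬?; contradiction; _×-dec_; _⊎-dec_)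
open import Relation.Unary using (Pred; Decidable; ∅)
open import Relation.Unary.Properties using (∅?)
open import Level using (0ℓ)

-- Vertices are labelled by Fin m.  Decidable adjacency makes the graph
-- classical finite data, so the burning number below is computable.
record Graph (m : ℕ) : Set₁ where
  field
    Adj       : Rel (Fin m) 0ℓ
    adj?      : Binary.Decidable Adj
    symmetric : Symmetric Adj
    loopless  : ∀ v → ¬ Adj v v

module _ {m : ℕ} (G : Graph m) where
  open Graph G

  IsClique : Subset m → Set
  IsClique S = ∀ u v → u ∈ S → v ∈ S → u ≢ v → Adj u v

  IsIndependent : Subset m → Set
  IsIndependent S = ∀ u v → u ∈ S → v ∈ S → ¬ Adj u v

  -- Either part of the partition may be empty.
  IsSplit : Set
  IsSplit = ∃[ K ] IsClique K × IsIndependent (∁ K)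

  Reachable : Rel (Fin m) 0ℓ
  Reachable = Star Adj

  Disconnected : Set
  Disconnected = ¬ (∀ u v → Reachable u v)

  IsComponent : Subset m → Set
  IsComponent C = ∃[ u ] ∀ v → v ∈ C ⇔ Reachable u v

  IsNontrivialComponent : Subset m → Set
  IsNontrivialComponent C = IsComponent C × ∣ C ∣ ≥ 2

  IsIsolated : Pred (Fin m) 0ℓ
  IsIsolated v = ∀ u → ¬ Adj u v

  -- G has exactly n isolated vertices.
  IsolatedCount : ℕ → Set
  IsolatedCount n = ∃[ I ] (∀ v → v ∈ I ⇔ IsIsolated v) × ∣ I ∣ ≡ n

  -- The burned vertices after a round with source x, given the set B of
  -- vertices burned at the end of the previous round.
  burnRound : Pred (Fin m) 0ℓ → Fin m → Pred (Fin m) 0ℓ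
  burnRound B x v = B v ⊎ v ≡ x ⊎ ∃[ u ] B u × Adj u v

  -- From B, some choice of sources makes the process last exactly k more
  -- rounds.  Each round needs an unburned source, so the process cannot
  -- continue once every vertex is burned.
  BurnsFrom : Pred (Fin m) 0ℓ → ℕ → Set
  BurnsFrom B zero    = ∀ v → B v
  BurnsFrom B (suc k) = ∃[ x ] ¬ B x × BurnsFrom (burnRound B x) k

  BurnsIn : ℕ → Set
  BurnsIn = BurnsFrom ∅

  IsBurningNumber : ℕ → Set
  IsBurningNumber k = BurnsIn k × (∀ j → BurnsIn j → k ≤ j)

  private
    burnRound? : ∀ {B} → Decidable B → ∀ x → Decidable (burnRound B x)
    burnRound? B? x v =
      B? v ⊎-dec (v ≟ x) ⊎-dec any? (λ u → B? u ×-dec adj? u v)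

    burnsFrom? : ∀ {B} → Decidable B → Decidable (BurnsFrom B)
    burnsFrom? B? zero    = all? B?
    burnsFrom? B? (suc k) =
      any? (λ x → ¬? (B? x) ×-dec burnsFrom? (burnRound? B? x) k)

    -- Choosing the unburned vertex with the largest label each time, the
    -- unburned vertices always have labels below d.
    terminates : ∀ d {B} → Decidable B → (∀ v → B v ⊎ toℕ v < d) →
                 ∃ (BurnsFrom B)
    terminates zero B? inv = zero , λ v → burned (inv v)
      where
      burned : ∀ {A : Set} {i} → A ⊎ i < 0 → A
      burned (inj₁ a) = a
    terminates (suc d) {B} B? inv
      with any? (λ v → ¬? (B? v) ×-dec (toℕ v ℕ.≟ d))
    ... | yes (x , ¬Bx , x≡d) =
      let k , p = terminates d (burnRound? B? x) inv′ in suc k , x , ¬Bx , p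
      where
      inv′ : ∀ v → burnRound B x v ⊎ toℕ v < d
      inv′ v with inv v | toℕ v ℕ.≟ d
      ... | inj₁ Bv  | _       = inj₁ (inj₁ Bv)
      ... | inj₂ _   | yes v≡d =
        inj₁ (inj₂ (inj₁ (toℕ-injective (trans v≡d (sym x≡d)))))
      ... | inj₂ v≤d | no v≢d  = inj₂ (ℕ.≤∧≢⇒< (s≤s⁻¹ v≤d) v≢d)
    ... | no none = terminates d B? inv′
      where
      inv′ : ∀ v → B v ⊎ toℕ v < d
      inv′ v with inv v | B? v
      ... | _        | yes Bv = inj₁ Bv
      ... | inj₁ Bv  | no _   = inj₁ Bv
      ... | inj₂ v≤d | no ¬Bv =
        inj₂ (ℕ.≤∧≢⇒< (s≤s⁻¹ v≤d) (λ v≡d → none (v , ¬Bv , v≡d)))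

    least : ∀ {P : Pred ℕ 0ℓ} → Decidable P → ∀ k → P k →
            ∃[ l ] P l × (∀ j → P j → l ≤ j)
    least P? zero    p = zero , p , λ _ _ → ℕ.z≤n
    least {P} P? (suc k) p with P? zero
    ... | yes p₀ = zero , p₀ , λ _ _ → ℕ.z≤n
    ... | no ¬p₀ with least (λ i → P? (suc i)) k p
    ...   | l , pl , min = suc l , pl , min′
      where
      min′ : ∀ j → P j → suc l ≤ j
      min′ zero    p₀ = contradiction p₀ ¬p₀
      min′ (suc j) pj = ℕ.s≤s (min j pj)

  burningNumber : ∃ IsBurningNumber
  burningNumber =
    let k , p = terminates m ∅? (λ v → inj₂ (toℕ<n v))
    in least (burnsFrom? ∅?) k p

  b : ℕ
  b = proj₁ burningNumber

{-# OPTIONS --safe #-}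

-- Label vertices by component.  A source touches only its own component, so
-- each round decreases the number of labels untouched by fire by at most one,
-- and b(G) is at least the number of components.
--
-- Conversely, let h be a non-isolated vertex of the clique K.  Every edge has
-- an endpoint in K, hence every non-isolated vertex is at distance at most 2
-- from h, and starting with h burns all of them within three rounds.  The
-- sources of all other rounds can be isolated vertices, except perhaps the
-- third one when there is only one isolated vertex.
module Submission where

open import Defs
open import Data.Bool using (true)
open import Data.Empty using (⊥-elim)
open import Data.Fin using (Fin; zero; suc)
open import Data.Fin.Properties using (_≟_; all?; any?; ¬∀⟶∃¬)
open import Data.Fin.Subset using (Subset; inside; outside; _∈_; _∉_; _∪_; _-_; ⁅_⁆; ∣_∣; Nonempty)
open import Data.Fin.Subset.Properties
  using ( _∈?_; nonempty?; Empty-unique; ∣⊥∣≡0; p─⊥≡p; p─q⊆p; p⊆q⇒∣p∣≤∣q∣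
        ; x∈⁅x⁆; x∈⁅y⁆⇒x≡y; x∈p∪q⁻; x∈p∪q⁺; x∉p⇒x∈∁p; x∈p∧x≢y⇒x∈p-y; x∈p⇒∣p-x∣<∣p∣)
open import Data.Nat using (ℕ; zero; suc; _+_; _⊔_; _≤_; _<_; _≥_; _≰_; z≤n; s≤s; s≤s⁻¹)
open import Data.Nat.Properties
  using (≤-trans; ≤-reflexive; ≤-antisym; ≰⇒>; n≤1+n; +-comm; +-monoʳ-≤; m≤n⇒m≤1+n; <⇒≱; m≤m⊔n; m≤n⊔m
        ; m≤n⇒m⊔n≡n; m≥n⇒m⊔n≡m)
open import Data.Product using (∃; ∃-syntax; _×_; _,_; proj₁; proj₂)
open import Data.Sum using (_⊎_; inj₁; inj₂)
open import Data.Vec using (_∷_; there; tabulate)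
open import Data.Vec.Properties using (lookup⇒[]=; []=⇒lookup; lookup∘tabulate)
open import Function using (_⇔_; mk⇔; Equivalence)
open import Level using (0ℓ)
open import Relation.Binary.Construct.Closure.ReflexiveTransitive using (ε; _◅_; _◅◅_)
open import Relation.Binary.PropositionalEquality using (_≡_; _≢_; refl; sym; trans; cong; subst)
open import Relation.Nullary using (¬_; yes; no; does; contradiction; _×-dec_; _⊎-dec_)
open import Relation.Nullary.Decidable using (dec-true; decidable-stable)
open import Relation.Unary using (Pred; Decidable; ∅)
open import Relation.Unary.Properties using (∅?)

-- Cardinality of finite subsets.

∣p∣≤1+∣p-x∣ : ∀ {n} (p : Subset n) x → ∣ p ∣ ≤ suc ∣ p - x ∣
∣p∣≤1+∣p-x∣ (inside  ∷ p) zero    = s≤s (≤-reflexive (cong ∣_∣ (sym (p─⊥≡p p))))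
∣p∣≤1+∣p-x∣ (outside ∷ p) zero    = m≤n⇒m≤1+n (≤-reflexive (cong ∣_∣ (sym (p─⊥≡p p))))
∣p∣≤1+∣p-x∣ (inside  ∷ p) (suc x) = s≤s (∣p∣≤1+∣p-x∣ p x)
∣p∣≤1+∣p-x∣ (outside ∷ p) (suc x) = ∣p∣≤1+∣p-x∣ p x

x∉p-x : ∀ {n} (p : Subset n) x → x ∉ p - x
x∉p-x (_ ∷ p) (suc x) (there x∈) = x∉p-x p x x∈

y∈p-x⇒y≢x : ∀ {n} {p : Subset n} {x y} → y ∈ p - x → y ≢ x
y∈p-x⇒y≢x {p = p} y∈ refl = x∉p-x p _ y∈

Empty⇒∣p∣≡0 : ∀ {n} {p : Subset n} → ¬ Nonempty p → ∣ p ∣ ≡ 0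
Empty⇒∣p∣≡0 {n} empty = trans (cong ∣_∣ (Empty-unique empty)) (∣⊥∣≡0 n)

1≤∣p∣⇒Nonempty : ∀ {n} (p : Subset n) → 1 ≤ ∣ p ∣ → Nonempty p
1≤∣p∣⇒Nonempty p 1≤ = decidable-stable (nonempty? p) λ empty →
  <⇒≱ 1≤ (≤-reflexive (Empty⇒∣p∣≡0 empty))

x∉p⇒∣p∣<∣p∪⁅x⁆∣ : ∀ {n} {p : Subset n} {x} → x ∉ p → ∣ p ∣ < ∣ p ∪ ⁅ x ⁆ ∣
x∉p⇒∣p∣<∣p∪⁅x⁆∣ {p = p} {x} x∉p = ≤-trans
  (s≤s (p⊆q⇒∣p∣≤∣q∣ {p = p} {q = p ∪ ⁅ x ⁆ - x} λ y∈p →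
    x∈p∧x≢y⇒x∈p-y (x∈p∪q⁺ (inj₁ y∈p)) λ { refl → x∉p y∈p }))
  (x∈p⇒∣p-x∣<∣p∣ {p = p ∪ ⁅ x ⁆} (x∈p∪q⁺ (inj₂ (x∈⁅x⁆ x))))

fromDecidable : ∀ {n} {P : Pred (Fin n) 0ℓ} → Decidable P → ∃[ p ] ∀ x → x ∈ p ⇔ P x
fromDecidable {P = P} P? = tabulate side , λ x → mk⇔
  (λ x∈p → to x (trans (sym (lookup∘tabulate side x)) ([]=⇒lookup x∈p)))
  (λ Px → lookup⇒[]= x _ (trans (lookup∘tabulate side x) (dec-true (P? x) Px)))
  where
  side = λ x → does (P? x)
  to : ∀ x → does (P? x) ≡ true → P x
  to x eq with yes Px ← P? x = Px

-- Burning in an arbitrary graph.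

module _ {m : ℕ} (G : Graph m) where
  open Graph G

  burnRound? : ∀ {B} → Decidable B → ∀ x → Decidable (burnRound G B x)
  burnRound? B? x v = B? v ⊎-dec (v ≟ x) ⊎-dec any? (λ u → B? u ×-dec adj? u v)

  isolated-unburned : ∀ {B x v} → IsIsolated G v → ¬ B v → v ≢ x → ¬ burnRound G B x v
  isolated-unburned iso ¬Bv v≢x (inj₁ Bv)                   = ¬Bv Bv
  isolated-unburned iso ¬Bv v≢x (inj₂ (inj₁ v≡x))           = v≢x v≡x
  isolated-unburned iso ¬Bv v≢x (inj₂ (inj₂ (u , _ , adj))) = iso u adj

  -- Any unburned source lies in `U` and can be struck from it, so each round shrinks `U`. The fire
  -- may also spread and finish early, and no source is then left to choose; hence some `j ≤ k`
  -- rather than `k` itself.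
  burnsFrom-≤ : ∀ k {B} → Decidable B → (U : Subset m) → (∀ v → B v ⊎ v ∈ U) →
                ∣ U ∣ ≤ k → ∃[ j ] j ≤ k × BurnsFrom G B j
  burnsFrom-≤ k {B} B? U cover ∣U∣≤k with all? B?
  ... | yes all = 0 , z≤n , all
  ... | no ¬all with ¬∀⟶∃¬ m B B? ¬all
  ...   | x , ¬Bx with cover x
  ...     | inj₁ Bx  = contradiction Bx ¬Bx
  -- Since `x ∈ U`, the bound `k` is positive, so `step` has no zero case.
  ...     | inj₂ x∈U = step k (≤-trans (x∈p⇒∣p-x∣<∣p∣ x∈U) ∣U∣≤k)
    where
    cover′ : ∀ v → burnRound G B x v ⊎ v ∈ U - x
    cover′ v with cover v | v ≟ x
    ... | inj₁ Bv  | _       = inj₁ (inj₁ Bv)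
    ... | inj₂ _   | yes v≡x = inj₁ (inj₂ (inj₁ v≡x))
    ... | inj₂ v∈U | no v≢x  = inj₂ (x∈p∧x≢y⇒x∈p-y v∈U v≢x)
    step : ∀ k → ∣ U - x ∣ < k → ∃[ j ] j ≤ k × BurnsFrom G B j
    step (suc k) (s≤s le) =
      let j , j≤k , burns = burnsFrom-≤ k (burnRound? B? x) (U - x) cover′ le
      in suc j , s≤s j≤k , x , ¬Bx , burns

  -- Spreading along edges preserves `f`, so only the new source can touch a label of `L`, and at
  -- most one per round. Once all vertices are burned, every label in the image of `f` is touched,
  -- which forces `L` to be empty.
  untouched-labels-≤ : ∀ {p} (f : Fin m → Fin p) → (∀ {u v} → Adj u v → f u ≡ f v) →
    ∀ k {B} (L : Subset p) → (∀ {ℓ} → ℓ ∈ L → ∃[ v ] f v ≡ ℓ) → (∀ v → f v ∈ L → ¬ B v) →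
    BurnsFrom G B k → ∣ L ∣ ≤ k
  untouched-labels-≤ f f-adj zero L onto untouched all =
    ≤-reflexive (Empty⇒∣p∣≡0 λ (ℓ , ℓ∈L) →
      let v , fv≡ℓ = onto ℓ∈L in untouched v (subst (_∈ L) (sym fv≡ℓ) ℓ∈L) (all v))
  untouched-labels-≤ f f-adj (suc k) {B} L onto untouched (x , _ , burns) = ≤-trans
    (∣p∣≤1+∣p-x∣ L (f x))
    (s≤s (untouched-labels-≤ f f-adj k (L - f x) (λ ℓ∈ → onto (p─q⊆p L _ ℓ∈)) untouched′ burns))
    where
    untouched′ : ∀ v → f v ∈ L - f x → ¬ burnRound G B x v
    untouched′ v fv∈ (inj₁ Bv)                    = untouched v (p─q⊆p L _ fv∈) Bv
    untouched′ v fv∈ (inj₂ (inj₁ refl))           = x∉p-x L (f x) fv∈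
    untouched′ v fv∈ (inj₂ (inj₂ (u , Bu , adj))) =
      untouched u (subst (_∈ L) (sym (f-adj adj)) (p─q⊆p L _ fv∈)) Bu

  b-burns : BurnsIn G (b G)
  b-burns = proj₁ (proj₂ (burningNumber G))

  b-minimal : ∀ {j k} → j ≤ k → BurnsIn G j → b G ≤ k
  b-minimal j≤k burns = ≤-trans (proj₂ (proj₂ (burningNumber G)) _ burns) j≤k

  -- Non-isolated vertices and components.

  nonisolated⇒neighbour : ∀ {v} → ¬ IsIsolated G v → ∃ (Adj v)
  nonisolated⇒neighbour {v} ¬iso = decidable-stable (any? (adj? v)) λ none →
    ¬iso λ u adj → none (u , symmetric adj)

  reachable-neighbour : ∀ {u v} → ∃ (Adj u) → Reachable G u v → ∃ (Adj v)
  reachable-neighbour nbr ε            = nbr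
  reachable-neighbour nbr (u~w ◅ path) = reachable-neighbour (_ , symmetric u~w) path

  -- A second vertex of `C` is joined to `c` by a nonempty path, whose first edge gives `c` a
  -- neighbour. Any other vertex of `C` gets one by reversing the last edge of a path from `c`.
  nontrivial⇒neighbours : ∀ {C} → IsNontrivialComponent G C →
                          ∃[ c ] c ∈ C × (∀ {v} → v ∈ C → ∃ (Adj v))
  nontrivial⇒neighbours {C} ((c , component) , 2≤∣C∣)
    with 1≤∣p∣⇒Nonempty (C - c) (s≤s⁻¹ (≤-trans 2≤∣C∣ (∣p∣≤1+∣p-x∣ C c)))
  ... | v , v∈ with Equivalence.to (component v) (p─q⊆p C _ v∈)
  ...   | ε       = contradiction refl (y∈p-x⇒y≢x v∈)
  ...   | c~a ◅ _ = c , Equivalence.from (component c) ε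
                  , λ v∈C → reachable-neighbour (_ , c~a) (Equivalence.to (component _) v∈C)

  component-closed : ∀ {C} → IsComponent G C → ∀ {u v} → u ∈ C → Adj u v → v ∈ C
  component-closed (c , component) u∈C adj =
    Equivalence.from (component _) (Equivalence.to (component _) u∈C ◅◅ adj ◅ ε)

  -- Upper bound in split graphs.

  module _ (split : IsSplit G) where
    private
      K = proj₁ split
      clique = proj₁ (proj₂ split)
      independent = proj₂ (proj₂ split)

    edge-meets-K : ∀ {u v} → Adj u v → u ∈ K ⊎ v ∈ K
    edge-meets-K {u} {v} adj with u ∈? K | v ∈? K
    ... | yes u∈K | _       = inj₁ u∈K
    ... | no _    | yes v∈K = inj₂ v∈K
    ... | no u∉K  | no v∉K  =
      contradiction adj (independent u v (x∉p⇒x∈∁p u∉K) (x∉p⇒x∈∁p v∉K))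

    hub : ∀ {u v} → Adj u v → ∃[ h ] h ∈ K × ∃ (Adj h)
    hub {u} {v} adj with edge-meets-K adj
    ... | inj₁ u∈K = u , u∈K , v , adj
    ... | inj₂ v∈K = v , v∈K , u , symmetric adj

    -- The edge at `v` has an end in the clique, and that end, `v` or its neighbour, equals `h` or
    -- is adjacent to it.
    distance-≤2 : ∀ {h} → h ∈ K → ∀ {v} → ∃ (Adj v) →
                  v ≡ h ⊎ Adj h v ⊎ ∃[ w ] Adj h w × Adj w v
    distance-≤2 {h} h∈K {v} (a , v~a) with edge-meets-K v~a
    ... | inj₁ v∈K with v ≟ h
    ...   | yes v≡h = inj₁ v≡h
    ...   | no v≢h  = inj₂ (inj₁ (symmetric (clique v h v∈K h∈K v≢h)))
    distance-≤2 {h} h∈K {v} (a , v~a) | inj₂ a∈K with a ≟ h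
    ...   | yes refl = inj₂ (inj₁ (symmetric v~a))
    ...   | no a≢h   = inj₂ (inj₂ (a , symmetric (clique a h a∈K h∈K a≢h) , symmetric v~a))

    -- All non-isolated vertices are reachable from a hub, so they form a single component. Defining
    -- `C` by having a neighbour avoids having to decide reachability.
    edge⇒nontrivial : ∀ {u v} → Adj u v → ∃ (IsNontrivialComponent G)
    edge⇒nontrivial adj =
      let h , h∈K , a , h~a = hub adj
          C , C⇔ = fromDecidable (λ v → any? (adj? v))
          to : ∀ {v} → ∃ (Adj v) → Reachable G h v
          to nbr = reach (distance-≤2 h∈K nbr)
          h∈C = Equivalence.from (C⇔ h) (a , h~a)
          a∈C = Equivalence.from (C⇔ a) (h , symmetric h~a)
          a≢h = λ a≡h → loopless h (subst (Adj h) a≡h h~a)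
      in C
       , (h , λ v → mk⇔ (λ v∈C → to (Equivalence.to (C⇔ v) v∈C))
                        (λ path → Equivalence.from (C⇔ v) (reachable-neighbour (a , h~a) path)))
       , ≤-trans (s≤s (≤-trans (s≤s z≤n) (x∈p⇒∣p-x∣<∣p∣ (x∈p∧x≢y⇒x∈p-y a∈C a≢h))))
                 (x∈p⇒∣p-x∣<∣p∣ h∈C)
      where
      reach : ∀ {h v} → v ≡ h ⊎ Adj h v ⊎ ∃[ w ] Adj h w × Adj w v → Reachable G h v
      reach (inj₁ refl)                   = ε
      reach (inj₂ (inj₁ h~v))             = h~v ◅ ε
      reach (inj₂ (inj₂ (_ , h~w , w~v))) = h~w ◅ w~v ◅ ε

    -- The fire started at a hub needs up to three rounds, and the hub with the `n` isolated
    -- vertices makes `suc n` sources; the maximum of the two suffices.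
    edge⇒burns-≤ : ∀ {n} → IsolatedCount G n → n ≥ 1 → ∀ {u v} → Adj u v →
                   ∃[ j ] j ≤ 3 ⊔ suc n × BurnsIn G j
    edge⇒burns-≤ {n} (I , I⇔ , refl) n≥1 adj
      with hub adj | 1≤∣p∣⇒Nonempty I n≥1
    ... | h , h∈K , a , h~a | i , i∈I = choose (nonempty? (I - i))
      where
      isolated : ∀ {v} → v ∈ I → IsIsolated G v
      isolated v∈I = Equivalence.to (I⇔ _) v∈I

      isolated≢h : ∀ {v} → v ∈ I → v ≢ h
      isolated≢h v∈I refl = isolated v∈I a (symmetric h~a)

      B₁ B₂ : Pred (Fin m) 0ℓ
      B₁ = burnRound G ∅ h
      B₂ = burnRound G B₁ i

      B₁? : Decidable B₁
      B₁? = burnRound? ∅? h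
      B₂? : Decidable B₂
      B₂? = burnRound? B₁? i

      unburned₁ : ∀ {v} → v ∈ I → ¬ B₁ v
      unburned₁ v∈I = isolated-unburned (isolated v∈I) (λ ()) (isolated≢h v∈I)

      unburned₂ : ∀ {v} → v ∈ I - i → ¬ B₂ v
      unburned₂ v∈ = let v∈I = p─q⊆p I _ v∈ in
        isolated-unburned (isolated v∈I) (unburned₁ v∈I) (y∈p-x⇒y≢x v∈)

      -- Vertices at distance 0, 1, 2 from `h` are burned by rounds 1, 2, 3, whatever the third
      -- source `x` is.
      burned₃ : ∀ x {v} → ∃ (Adj v) → burnRound G B₂ x v
      burned₃ x nbr with distance-≤2 h∈K nbr
      ... | inj₁ v≡h                    = inj₁ (inj₁ (inj₂ (inj₁ v≡h)))
      ... | inj₂ (inj₁ h~v)             = inj₁ (inj₂ (inj₂ (h , inj₂ (inj₁ refl) , h~v)))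
      ... | inj₂ (inj₂ (w , h~w , w~v)) =
        inj₂ (inj₂ (w , inj₂ (inj₂ (h , inj₂ (inj₁ refl) , h~w)) , w~v))

      cover₃ : ∀ x v → burnRound G B₂ x v ⊎ v ∈ I - i - x
      cover₃ x v with v ∈? I | v ≟ i | v ≟ x
      ... | no v∉I  | _        | _       =
        inj₁ (burned₃ x (nonisolated⇒neighbour λ iso → v∉I (Equivalence.from (I⇔ v) iso)))
      ... | yes _   | yes v≡i  | _       = inj₁ (inj₁ (inj₂ (inj₁ v≡i)))
      ... | yes _   | no _     | yes v≡x = inj₁ (inj₂ (inj₁ v≡x))
      ... | yes v∈I | no v≢i   | no v≢x  = inj₂ (x∈p∧x≢y⇒x∈p-y (x∈p∧x≢y⇒x∈p-y v∈I v≢i) v≢x)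

      continue : ∀ x → ¬ B₂ x → ∀ k → ∣ I - i - x ∣ ≤ k → 3 + k ≤ 3 ⊔ suc ∣ I ∣ →
                 ∃[ j ] j ≤ 3 ⊔ suc ∣ I ∣ × BurnsIn G j
      continue x ¬B₂x k le 3+k≤ =
        let j , j≤k , burns = burnsFrom-≤ k (burnRound? B₂? x) (I - i - x) (cover₃ x) le
        in 3 + j , ≤-trans (+-monoʳ-≤ 3 j≤k) 3+k≤
         , h , (λ ()) , i , unburned₁ i∈I , x , ¬B₂x , burns

      choose : _ → ∃[ j ] j ≤ 3 ⊔ suc ∣ I ∣ × BurnsIn G j
      -- With a second isolated vertex as third source, `∣ I ∣` drops by two, so three rounds plus
      -- the rest make at most `suc ∣ I ∣`.
      choose (yes (x , x∈)) = continue x (unburned₂ x∈) _ (≤-reflexive refl)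
        (≤-trans (s≤s (≤-trans (s≤s (x∈p⇒∣p-x∣<∣p∣ x∈)) (x∈p⇒∣p-x∣<∣p∣ i∈I)))
                 (m≤n⊔m 3 (suc ∣ I ∣)))
      -- Here `i` is the only isolated vertex. Two rounds may already burn everything, leaving no
      -- legal third source; otherwise any unburned vertex serves, and round three is the last.
      choose (no empty) with all? B₂?
      ... | yes all = 2 , ≤-trans (n≤1+n 2) (m≤m⊔n 3 (suc ∣ I ∣)) , h , (λ ()) , i , unburned₁ i∈I , all
      ... | no ¬all =
        let x , ¬B₂x = ¬∀⟶∃¬ m B₂ B₂? ¬all
        in continue x ¬B₂x 0
             (≤-reflexive (Empty⇒∣p∣≡0 {p = I - i - x} λ (y , y∈) → empty (y , p─q⊆p (I - i) _ y∈)))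
             (m≤m⊔n 3 (suc ∣ I ∣))

  -- Lower bound from components, and the edgeless case.

  component⇒1+isolated-≤b : ∀ {n C} → IsNontrivialComponent G C →
    (∀ v → v ∉ C → IsIsolated G v) → IsolatedCount G n → suc n ≤ b G
  component⇒1+isolated-≤b {n} {C} nontrivial isolated (I , I⇔ , refl)
    with nontrivial⇒neighbours nontrivial
  ... | c , c∈C , neighbour = ≤-trans (x∉p⇒∣p∣<∣p∪⁅x⁆∣ (λ c∈I → isolated∉C c∈I c∈C))
    (untouched-labels-≤ label label-adj (b G) (I ∪ ⁅ c ⁆) (λ {ℓ} ℓ∈ → ℓ , label-fixes (x∈p∪q⁻ I _ ℓ∈))
      (λ _ _ ()) b-burns)
    where
    isolated∉C : ∀ {v} → v ∈ I → v ∉ C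
    isolated∉C v∈I v∈C = let a , v~a = neighbour v∈C in
      Equivalence.to (I⇔ _) v∈I a (symmetric v~a)

    -- Contracting `C` to `c` makes the labelling constant along edges, and each of the `suc n`
    -- labels in `I ∪ ⁅ c ⁆` is carried by itself.
    label : Fin m → Fin m
    label v with v ∈? C
    ... | yes _ = c
    ... | no _  = v

    label-adj : ∀ {u v} → Adj u v → label u ≡ label v
    label-adj {u} {v} adj with u ∈? C | v ∈? C
    ... | yes _   | yes _   = refl
    ... | yes u∈C | no v∉C  = contradiction (component-closed (proj₁ nontrivial) u∈C adj) v∉C
    ... | no u∉C  | _       = ⊥-elim (isolated u u∉C v (symmetric adj))

    label-fixes : ∀ {ℓ} → ℓ ∈ I ⊎ ℓ ∈ ⁅ c ⁆ → label ℓ ≡ ℓ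
    label-fixes {ℓ} ℓ∈ with ℓ ∈? C | ℓ∈
    ... | no _    | _          = refl
    ... | yes _   | inj₂ ℓ∈⁅c⁆ = sym (x∈⁅y⁆⇒x≡y c ℓ∈⁅c⁆)
    ... | yes ℓ∈C | inj₁ ℓ∈I   = contradiction ℓ∈C (isolated∉C ℓ∈I)

  -- Without edges `I` contains every vertex, which gives the upper bound; for the lower bound each
  -- vertex is its own label.
  edgeless⇒b≡n : ∀ {n} → (∀ {u v} → ¬ Adj u v) → IsolatedCount G n → b G ≡ n
  edgeless⇒b≡n {n} edgeless (I , I⇔ , refl) = ≤-antisym
    (let j , j≤ , burns = burnsFrom-≤ ∣ I ∣ ∅? I
                            (λ v → inj₂ (Equivalence.from (I⇔ v) λ _ → edgeless)) (≤-reflexive refl)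
     in b-minimal j≤ burns)
    (untouched-labels-≤ (λ v → v) (λ adj → contradiction adj edgeless) (b G) I
      (λ {v} _ → v , refl) (λ _ _ ()) b-burns)

theorem3p4 : ∀ {m : ℕ} (G : Graph m) → IsSplit G → Disconnected G →
    (∀ (n : ℕ) → ¬ ∃ (IsNontrivialComponent G) → IsolatedCount G n → b G ≡ n)
    ×
    (∀ (n : ℕ) (C : Subset m) → IsNontrivialComponent G C →
    (∀ v → v ∉ C → IsIsolated G v) → IsolatedCount G n → n ≥ 1 →
    (n ≤ 2 → b G ≤ 3) × (n ≰ 2 → b G ≡ n + 1))
theorem3p4 G split _ =
  (λ n trivial count → edgeless⇒b≡n G (λ adj → trivial (edge⇒nontrivial G split adj)) count) ,
  λ n C nontrivial isolated count n≥1 →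
    let c , c∈C , neighbour = nontrivial⇒neighbours G nontrivial
        _ , adj = neighbour c∈C
        j , j≤ , burns = edge⇒burns-≤ G split count n≥1 adj
        b≤ = b-minimal G j≤ burns
    -- The bound `3 ⊔ suc n` is `3` for `n ≤ 2` and `suc n` otherwise, where it meets the lower
    -- bound.
    in (λ n≤2 → ≤-trans b≤ (≤-reflexive (m≥n⇒m⊔n≡m (s≤s n≤2))))
     , (λ n≰2 → trans
         (≤-antisym (≤-trans b≤ (≤-reflexive (m≤n⇒m⊔n≡n (m≤n⇒m≤1+n (≰⇒> n≰2)))))
                    (component⇒1+isolated-≤b G nontrivial isolated count))
         (+-comm 1 n))
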